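{- $t(n)\in O\left(1.61^n\right)$.
   Context: Let $\mathfrak{C}=\{0,1\}^n$ be the vertex set of the $n$-dimensional hypercube; $\oplus,\wedge$ denote bitwise XOR and AND. An outmap is any function $s:\mathfrak{C}\to\{0,1\}^n$. A clash of $s$ is a pair of distinct vertices $u,v$ with $(s(u)\oplus s(v))\wedge(u\oplus v)=0^n$. A query at $u$ to the oracle for $s$ returns $s(u)$; algorithms choose queries adaptively, and only the number of queries is counted. \textsc{Sink-or-Clash}: given oracle access to an arbitrary outmap $s$, query either a vertex $u$ with $s(u)=0^n$ or both vertices of some clash. $t(n)=\min_{\mathcal A}\max_s t(\mathcal A,s)$, where $\mathcal A$ ranges over deterministic algorithms solving \textsc{Sink-or-Clash} on all outmaps of the $n$-cube and $t(\mathcal A,s)$ is the number of queries made on $s$. -}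

module Defs where

import Algebra.Definitions.RawSemiring as RawSemiringDefs
open import Data.Bool using (Bool; true; false; if_then_else_; _∧_; _xor_)
open import Data.Bool.Properties using (∧-zeroʳ; xor-same)
import Data.Bool.Properties as Bool
open import Data.List using (List; []; _∷_; [_]; _++_; map; length; take; filter; cartesianProductWith)
open import Data.List.Extrema.Nat using (argmax; argmin; f[xs]≤f[argmax]; f[argmin]≤f[xs]; f[argmin]≤f[⊤]; argmin-all)
open import Data.List.Membership.Propositional using (_∈_; lose)
open import Data.List.Membership.Propositional.Properties
  using (∈-map⁺; ∈-++⁺ˡ; ∈-++⁺ʳ; ∈-cartesianProductWith⁺; ∈-filter⁺)
open import Data.List.Properties using (take-all)
open import Data.List.Relation.Unary.All as All using (All; all?)
open import Data.List.Relation.Unary.All.Properties using (all-filter)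
open import Data.List.Relation.Unary.Any as Any using (Any; any?; here; there)
open import Data.Nat using (ℕ; zero; suc; _≤_; _≤?_)
open import Data.Nat.Properties using (≤-trans; ≤-reflexive; ≰⇒≥)
open import Data.Product using (∃; ∃₂; _×_; _,_; proj₁; proj₂)
open import Data.Rational as ℚ using (ℚ)
open import Data.Sum using (_⊎_; inj₁; inj₂)
open import Data.Vec using (Vec; []; _∷_; head; tail; replicate; zipWith)
open import Data.Vec.Properties using (≡-dec)
open import Relation.Binary.PropositionalEquality
  using (_≡_; _≢_; refl; sym; trans; cong; cong₂; subst)
open import Relation.Nullary using (Dec; yes; no; ¬?)
open import Relation.Nullary.Decidable as Dec using (_×-dec_; _⊎-dec_)

-- Vertices and oracle answers are both elements of {0,1}ⁿ.

Cube : ℕ → Set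
Cube = Vec Bool

0ⁿ : ∀ {n} → Cube n
0ⁿ {n} = replicate n false

infixl 6 _⊕_
infixl 7 _⋀_

_⊕_ _⋀_ : ∀ {n} → Cube n → Cube n → Cube n
_⊕_ = zipWith _xor_
_⋀_ = zipWith _∧_

Outmap : ℕ → Set
Outmap n = Cube n → Cube n

Sink : ∀ {n} → Outmap n → Cube n → Set
Sink s u = s u ≡ 0ⁿ

Clash : ∀ {n} → Outmap n → Cube n → Cube n → Set
Clash s u v = u ≢ v × (s u ⊕ s v) ⋀ (u ⊕ v) ≡ 0ⁿ

-- A deterministic adaptive query algorithm, as a decision tree: either it
-- halts, or it queries a vertex and continues depending on the answer.

data Algorithm (n : ℕ) : Set where
  halt  : Algorithm n
  query : (u : Cube n) (next : Cube n → Algorithm n) → Algorithm n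

queried : ∀ {n} → Algorithm n → Outmap n → List (Cube n)
queried halt           s = []
queried (query u next) s = u ∷ queried (next (s u)) s

queryCount : ∀ {n} → Algorithm n → Outmap n → ℕ
queryCount A s = length (queried A s)

SinkOrClash : ∀ {n} → Outmap n → List (Cube n) → Set
SinkOrClash s us = Any (Sink s) us ⊎ Any (λ u → Any (Clash s u) us) us

Solves : ∀ {n} → Algorithm n → Set
Solves A = ∀ s → SinkOrClash s (queried A s)

IsMaximum : {X : Set} → (X → ℕ) → ℕ → Set
IsMaximum f m = (∃ λ x → f x ≡ m) × (∀ x → f x ≤ m)

IsMinimumOn : {X : Set} → (X → Set) → (X → ℕ) → ℕ → Set
IsMinimumOn P f m = (∃ λ x → P x × f x ≡ m) × (∀ x → P x → m ≤ f x)

-- The maximum over outmaps and the minimum over algorithms exist because,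
-- up to pointwise equality, there are finitely many functions between finite
-- cubes and finitely many decision trees of bounded depth.

private
  variable
    n : ℕ
    B X : Set

  maximum-exists : (f : X → ℕ) (x₀ : X) (xs : List X) →
    (∀ x → ∃ λ x′ → x′ ∈ xs × f x ≤ f x′) → ∃ (IsMaximum f)
  maximum-exists f x₀ xs covered = _ , (argmax f x₀ xs , refl) , λ x →
    let (_ , x′∈ , fx≤) = covered x
    in ≤-trans fx≤ (All.lookup (f[xs]≤f[argmax] {f = f} x₀ xs) x′∈)

  minimum-exists : {P : X → Set} → (∀ x → Dec (P x)) →
    (f : X → ℕ) (x₀ : X) → P x₀ → (xs : List X) →
    (∀ x → P x → f x ≤ f x₀ → ∃ λ x′ → x′ ∈ xs × P x′ × f x′ ≤ f x) →
    ∃ (IsMinimumOn P f)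
  minimum-exists {P = P} P? f x₀ px₀ xs covered =
    _ , (argmin f x₀ ys , argmin-all f px₀ (all-filter P? xs) , refl) , bound
    where
    ys = filter P? xs
    bound : ∀ x → P x → f (argmin f x₀ ys) ≤ f x
    bound x px with f x ≤? f x₀
    ... | no  fx≰fx₀ = ≤-trans (f[argmin]≤f[⊤] {f = f} x₀ ys) (≰⇒≥ fx≰fx₀)
    ... | yes fx≤fx₀ with covered x px fx≤fx₀
    ...   | _ , x′∈ , px′ , fx′≤ =
      ≤-trans (All.lookup (f[argmin]≤f[xs] {f = f} x₀ ys) (∈-filter⁺ P? x′∈ px′)) fx′≤

  functions : ∀ k → List B → List (Cube k → B)
  functions zero    ys = map (λ y _ → y) ys
  functions (suc k) ys = cartesianProductWith
    (λ f g v → if head v then f (tail v) else g (tail v))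
    (functions k ys) (functions k ys)

  functions-complete : ∀ k (ys : List B) (R : Cube k → B → Set) →
    (∀ v → ∃ λ y → y ∈ ys × R v y) →
    ∃ λ f → f ∈ functions k ys × (∀ v → R v (f v))
  functions-complete zero ys R h with h []
  ... | y , y∈ys , r = _ , ∈-map⁺ (λ y _ → y) y∈ys , λ { [] → r }
  functions-complete (suc k) ys R h
    with functions-complete k ys (λ v → R (true ∷ v)) (λ v → h (true ∷ v))
       | functions-complete k ys (λ v → R (false ∷ v)) (λ v → h (false ∷ v))
  ... | f , f∈ , rf | g , g∈ , rg =
    _ , ∈-cartesianProductWith⁺ _ f∈ g∈ ,
    λ { (true ∷ v) → rf v ; (false ∷ v) → rg v }

  vertices : ∀ n → List (Cube n)
  vertices zero    = [ [] ]
  vertices (suc n) = map (true ∷_) (vertices n) ++ map (false ∷_) (vertices n)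

  ∈-vertices : (v : Cube n) → v ∈ vertices n
  ∈-vertices []          = here refl
  ∈-vertices (true  ∷ v) = ∈-++⁺ˡ (∈-map⁺ (true ∷_) (∈-vertices v))
  ∈-vertices (false ∷ v) = ∈-++⁺ʳ _ (∈-map⁺ (false ∷_) (∈-vertices v))

  outmaps : ∀ n → List (Outmap n)
  outmaps n = functions n (vertices n)

  outmaps-complete : (s : Outmap n) → ∃ λ s′ → s′ ∈ outmaps n × (∀ v → s v ≡ s′ v)
  outmaps-complete {n} s =
    functions-complete n (vertices n) (λ v y → s v ≡ y) (λ v → s v , ∈-vertices _ , refl)

  queried-cong : (A : Algorithm n) {s s′ : Outmap n} → (∀ v → s v ≡ s′ v) →
                 queried A s ≡ queried A s′
  queried-cong halt           eq = refl
  queried-cong (query u next) {s} eq rewrite sym (eq u) =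
    cong (u ∷_) (queried-cong (next (s u)) eq)

  SinkOrClash-cong : ∀ {s s′ : Outmap n} {us} → (∀ v → s v ≡ s′ v) →
                     SinkOrClash s us → SinkOrClash s′ us
  SinkOrClash-cong eq (inj₁ p) = inj₁ (Any.map (λ {u} → trans (sym (eq u))) p)
  SinkOrClash-cong {s = s} {s′} eq (inj₂ p) = inj₂ (Any.map (λ {u} → Any.map (λ {v} → clash u v)) p)
    where
    clash : ∀ u v → Clash s u v → Clash s′ u v
    clash u v (u≢v , c) =
      u≢v , trans (cong (_⋀ (u ⊕ v)) (sym (cong₂ _⊕_ (eq u) (eq v)))) c

  _≟_ : (u v : Cube n) → Dec (u ≡ v)
  _≟_ = ≡-dec Bool._≟_

  sinkOrClash? : (s : Outmap n) (us : List (Cube n)) → Dec (SinkOrClash s us)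
  sinkOrClash? s us =
    any? (λ u → s u ≟ 0ⁿ) us ⊎-dec
    any? (λ u → any? (λ v → ¬? (u ≟ v) ×-dec ((s u ⊕ s v) ⋀ (u ⊕ v)) ≟ 0ⁿ) us) us

  solves? : (A : Algorithm n) → Dec (Solves A)
  solves? {n} A = Dec.map′ to (λ sol → All.tabulate (λ {s} _ → sol s))
    (all? (λ s → sinkOrClash? s (queried A s)) (outmaps n))
    where
    to : All (λ s → SinkOrClash s (queried A s)) (outmaps n) → Solves A
    to sol s with outmaps-complete s
    ... | s′ , s′∈ , eq = SinkOrClash-cong (λ v → sym (eq v))
      (subst (SinkOrClash s′) (sym (queried-cong A eq)) (All.lookup sol s′∈))

opaque
  worstCase-exists : (A : Algorithm n) → ∃ (IsMaximum (queryCount A))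
  worstCase-exists {n} A = maximum-exists (queryCount A) (λ u → u) (outmaps n) covered
    where
    covered : ∀ s → ∃ λ s′ → s′ ∈ outmaps n × queryCount A s ≤ queryCount A s′
    covered s with outmaps-complete s
    ... | s′ , s′∈ , eq = s′ , s′∈ , ≤-reflexive (cong length (queried-cong A eq))

worstCase : Algorithm n → ℕ
worstCase A = proj₁ (worstCase-exists A)

worstCase-isMaximum : (A : Algorithm n) → IsMaximum (queryCount A) (worstCase A)
worstCase-isMaximum A = proj₂ (worstCase-exists A)

private
  queryAll : List (Cube n) → Algorithm n
  queryAll []       = halt
  queryAll (u ∷ us) = query u (λ _ → queryAll us)

  queried-queryAll : (us : List (Cube n)) (s : Outmap n) → queried (queryAll us) s ≡ us
  queried-queryAll []       s = refl
  queried-queryAll (u ∷ us) s = cong (u ∷_) (queried-queryAll us s)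

  ⊕-self : (u : Cube n) → u ⊕ u ≡ 0ⁿ
  ⊕-self []      = refl
  ⊕-self (b ∷ u) = cong₂ _∷_ (xor-same b) (⊕-self u)

  0ⁿ-⋀ : (u : Cube n) → 0ⁿ ⋀ u ≡ 0ⁿ
  0ⁿ-⋀ []      = refl
  0ⁿ-⋀ (b ∷ u) = cong (false ∷_) (0ⁿ-⋀ u)

  sink-or-clash : (s : Outmap n) → ∃ (Sink s) ⊎ ∃₂ (Clash s)
  sink-or-clash {zero} s with s [] in eq
  ... | [] = inj₁ ([] , eq)
  sink-or-clash {suc n} s = combine (facet false) (facet true)
    where
    FacetResult : Bool → Set
    FacetResult b = (∃ λ v → ∃ λ x → s (b ∷ v) ≡ x ∷ 0ⁿ) ⊎ ∃₂ (Clash s)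

    clash : ∀ b u v → Clash (λ w → tail (s (b ∷ w))) u v → Clash s (b ∷ u) (b ∷ v)
    clash b u v (u≢v , c) with s (b ∷ u) | s (b ∷ v)
    ... | x ∷ _ | y ∷ _ = (λ { refl → u≢v refl }) ,
      cong₂ _∷_ (trans (cong ((x xor y) ∧_) (xor-same b)) (∧-zeroʳ _)) c

    facet : ∀ b → FacetResult b
    facet b with sink-or-clash (λ v → tail (s (b ∷ v)))
    ... | inj₂ (u , v , c) = inj₂ (b ∷ u , b ∷ v , clash b u v c)
    ... | inj₁ (v , sink) with s (b ∷ v) in eq
    ...   | x ∷ _ = inj₁ (v , x , trans eq (cong (x ∷_) sink))

    combine : FacetResult false → FacetResult true → ∃ (Sink s) ⊎ ∃₂ (Clash s)
    combine (inj₂ c) _ = inj₂ c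
    combine (inj₁ _) (inj₂ c) = inj₂ c
    combine (inj₁ (u , false , p)) (inj₁ _) = inj₁ (false ∷ u , p)
    combine (inj₁ (u , true , p)) (inj₁ (v , false , q)) = inj₁ (true ∷ v , q)
    combine (inj₁ (u , true , p)) (inj₁ (v , true , q)) =
      inj₂ (false ∷ u , true ∷ v , (λ ()) ,
        trans (cong (_⋀ ((false ∷ u) ⊕ (true ∷ v)))
                (trans (cong₂ _⊕_ p q) (⊕-self (true ∷ 0ⁿ))))
              (0ⁿ-⋀ ((false ∷ u) ⊕ (true ∷ v))))

  queryAll-solves : ∀ n → Solves (queryAll (vertices n))
  queryAll-solves n s rewrite queried-queryAll (vertices n) s with sink-or-clash s
  ... | inj₁ (u , sink)  = inj₁ (lose (∈-vertices u) sink)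
  ... | inj₂ (u , v , c) = inj₂ (lose (∈-vertices u) (lose (∈-vertices v) c))

  algorithms : ∀ n → ℕ → List (Algorithm n)
  algorithms n zero    = [ halt ]
  algorithms n (suc d) = halt ∷
    cartesianProductWith query (vertices n) (functions n (algorithms n d))

  algorithms-complete : ∀ d (A : Algorithm n) →
    ∃ λ A′ → A′ ∈ algorithms n d × (∀ s → take d (queried A s) ≡ queried A′ s)
  algorithms-complete zero    A    = halt , here refl , λ _ → refl
  algorithms-complete (suc d) halt = halt , here refl , λ _ → refl
  algorithms-complete {n} (suc d) (query u next)
    with functions-complete n (algorithms n d)
           (λ a A′ → ∀ s → take d (queried (next a) s) ≡ queried A′ s)
           (λ a → algorithms-complete d (next a))
  ... | next′ , next′∈ , eq =
    query u next′ , there (∈-cartesianProductWith⁺ query (∈-vertices u) next′∈) ,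
    λ s → cong (u ∷_) (eq (s u) s)

  worstCase-cong : (A A′ : Algorithm n) → (∀ s → queried A s ≡ queried A′ s) →
                   worstCase A′ ≤ worstCase A
  worstCase-cong A A′ eq with worstCase-isMaximum A′
  ... | (s , attained) , _ = ≤-trans
    (≤-reflexive (trans (sym attained) (cong length (sym (eq s)))))
    (proj₂ (worstCase-isMaximum A) s)

opaque
  complexity-exists : ∀ n → ∃ (IsMinimumOn (Solves {n}) worstCase)
  complexity-exists n =
    minimum-exists {P = Solves} solves? worstCase A₀ (queryAll-solves n) (algorithms n d) covered
    where
    A₀ : Algorithm n
    A₀ = queryAll (vertices n)
    d : ℕ
    d = worstCase A₀
    covered : ∀ (A : Algorithm n) → Solves A → worstCase A ≤ d →
              ∃ λ A′ → A′ ∈ algorithms n d × Solves A′ × worstCase A′ ≤ worstCase A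
    covered A sol w≤d with algorithms-complete d A
    ... | A′ , A′∈ , eq =
      A′ , A′∈ , (λ s → subst (SinkOrClash s) (same s) (sol s)) , worstCase-cong A A′ same
      where
      same : ∀ s → queried A s ≡ queried A′ s
      same s = trans
        (sym (take-all d (queried A s) (≤-trans (proj₂ (worstCase-isMaximum A) s) w≤d)))
        (eq s)

t : ℕ → ℕ
t n = proj₁ (complexity-exists n)

t-isMinimum : ∀ n → IsMinimumOn (Solves {n}) worstCase (t n)
t-isMinimum n = proj₂ (complexity-exists n)

infixr 8 _^_
_^_ : ℚ → ℕ → ℚ
_^_ = RawSemiringDefs._^_ ℚ.+-*-rawSemiring

infix 4 _∈O_
_∈O_ : (f g : ℕ → ℚ) → Set
f ∈O g = ∃ λ (c : ℚ) → ∃ λ (n₀ : ℕ) → ∀ n → n₀ ≤ n → ℚ.∣ f n ∣ ℚ.≤ c ℚ.* ℚ.∣ g n ∣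

-- This is the Fibonacci seesaw of Szabó and Welzl, with the 4-cube as its last
-- stage. Regard the n-cube as a quotient cube of faces: a sink of every face
-- gives an inherited outmap on the quotient, whose sinks and clashes are sinks
-- and clashes of s. Once sinks of two antipodal j-faces are known, their answers
-- differ in some quotient coordinate (or clash); extending both faces by it, one
-- of the two sinks stays a sink and the other face needs one new evaluation of
-- dimension j. So antipodal sinks of dimension j cost 2 + t(0) + … + t(j - 1).
-- When the quotient is a 4-cube with its two poles known, a finite search shows
-- that 5 further evaluations suffice, while seesawing on to the end would amount
-- to about 5.24 (their cost growing by the golden ratio). Hence
-- t(n + 4) ≤ 2 + t(0) + … + t(n - 1) + 5 t(n), and 1.61⁴ > 5 + 1/0.61.

module Submission where

open import Defs
open import Data.Integer using (+_)
open import Data.Rational using (ℚ; _/_)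
import Algebra.Properties.CommutativeSemigroup as CommutativeSemigroup
import Data.Bool.ListAction as Bool
import Data.Bool.Properties as Bool
import Data.Integer as ℤ
import Data.Integer.Properties as ℤ
import Data.Nat as ℕ
import Data.Nat.Properties as ℕ
import Data.Rational as ℚ
import Data.Rational.Properties as ℚ
import Data.Rational.Unnormalised as ℚᵘ
import Data.Rational.Unnormalised.Properties as ℚᵘ
open import Algebra.Bundles using (CommutativeMonoid)
open import Data.Bool using (Bool; true; false; T; T?; not; if_then_else_; _∧_; _∨_; _xor_)
open import Data.Bool.Properties using (T-∨; ∧-zeroʳ; xor-same)
open import Data.Empty using (⊥-elim)
open import Data.Fin using (Fin; zero; suc)
open import Data.List using (List; []; _∷_; _++_; map; null; filterᵇ; cartesianProductWith; allFin)
open import Data.List.Membership.Propositional using (_∈_; find; lose)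
open import Data.List.Membership.Propositional.Properties using (∈-cartesianProductWith⁺; ∈-filter⁺)
open import Data.List.Relation.Binary.Subset.Propositional using (_⊆_)
open import Data.List.Relation.Unary.All as All using (All; []; _∷_)
open import Data.List.Relation.Unary.All.Properties using (all⁺; map⁺)
open import Data.List.Relation.Unary.Any as Any using (Any; here; there)
open import Data.List.Relation.Unary.Any.Properties using (any⁻)
open import Data.Nat using (ℕ; zero; suc; _+_; _*_; _≤_; z≤n; s≤s; _≡ᵇ_)
open import Data.Nat.Tactic.RingSolver using (solve-∀)
open import Data.Product using (∃; ∃₂; _×_; _,_; proj₁; proj₂)
open import Data.Sum using (_⊎_; inj₁; inj₂; [_,_])
open import Data.Vec using ([]; _∷_; lookup; count; insertAt; removeAt; replicate)
open import Data.Vec.Properties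
  using (≡-dec; ∷-injective; insertAt-lookup; removeAt-insertAt; insertAt-removeAt)
open import Function using (id; _∘_; Equivalence)
open import Relation.Binary.PropositionalEquality
  using (_≡_; _≢_; refl; sym; trans; cong; cong₂; subst; subst₂; module ≡-Reasoning)
open import Relation.Nullary using (Dec; yes; no)
open import Relation.Nullary.Decidable using (⌊_⌋; toWitness)

private
  variable
    c d i k m n : ℕ

_≟_ : (u v : Cube n) → Dec (u ≡ v)
_≟_ = ≡-dec Bool._≟_

1ⁿ : Cube n
1ⁿ {n} = replicate n true

-- Histories of vertex–answer pairs

Agree : (a b u v : Cube n) → Set
Agree a b u v = (a ⊕ b) ⋀ (u ⊕ v) ≡ 0ⁿ

agree-answer : (a u v : Cube n) → Agree a a u v
agree-answer []       []       []       = refl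
agree-answer (a ∷ as) (_ ∷ us) (_ ∷ vs) =
  cong₂ _∷_ (cong (_∧ _) (xor-same a)) (agree-answer as us vs)

agree-vertex : (a b u : Cube n) → Agree a b u u
agree-vertex []       []       []       = refl
agree-vertex (_ ∷ as) (_ ∷ bs) (u ∷ us) =
  cong₂ _∷_ (trans (cong (_ ∧_) (xor-same u)) (∧-zeroʳ _)) (agree-vertex as bs us)

History : ℕ → Set
History n = List (Cube n × Cube n)

data Found {n} (H : History n) : Set where
  sink  : ∀ {u} → (u , 0ⁿ) ∈ H → Found H
  clash : ∀ {u a v b} → (u , a) ∈ H → (v , b) ∈ H → u ≢ v → Agree a b u v → Found H

Found-mono : {H H′ : History n} → H ⊆ H′ → Found H → Found H′
Found-mono sub (sink u∈)             = sink (sub u∈)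
Found-mono sub (clash u∈ v∈ u≢v agr) = clash (sub u∈) (sub v∈) u≢v agr

-- The game against an adversary who answers queries without committing to an
-- outmap: P can be forced from H with at most c more queries.
data Win (P : History n → Set) : ℕ → History n → Set where
  done : ∀ {H} → P H → Win P c H
  ask  : ∀ {H} u → (∀ a → Win P c ((u , a) ∷ H)) → Win P (suc c) H

Win-weaken : ∀ {P : History n → Set} {H} → c ≤ d → Win P c H → Win P d H
Win-weaken c≤d       (done p)  = done p
Win-weaken (s≤s c≤d) (ask u w) = ask u (λ a → Win-weaken c≤d (w a))

Win-map : ∀ {P Q : History n → Set} {H} → (∀ {H} → P H → Q H) → Win P c H → Win Q c H
Win-map f (done p)  = done (f p)
Win-map f (ask u w) = ask u (λ a → Win-map f (w a))

infixl 1 _>>=_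
_>>=_ : ∀ {P Q : History n → Set} {H} → Win P c H →
        (∀ {H′} → H ⊆ H′ → P H′ → Win Q d H′) → Win Q (c + d) H
done p  >>= f = Win-weaken (ℕ.m≤n+m _ _) (f id p)
ask u w >>= f = ask u (λ a → w a >>= λ sub → f (sub ∘ there))

_∨Found : (History n → Set) → History n → Set
(P ∨Found) H = Found H ⊎ P H

-- From winning strategies to algorithms

algorithm : {H : History n} → Win Found c H → Algorithm n
algorithm (done _)  = halt
algorithm (ask u w) = query u (λ a → algorithm (w a))

queryCount-algorithm : {H : History n} (w : Win Found c H) (s : Outmap n) →
                       queryCount (algorithm w) s ≤ c
queryCount-algorithm (done _)  s = z≤n
queryCount-algorithm (ask u w) s = s≤s (queryCount-algorithm (w (s u)) s)

-- `us` is the full list of queries and stays fixed while the recursion descends, so it contains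
-- both the vertices of the history and those still to be asked.
algorithm-finds : {H : History n} (w : Win Found c H) (s : Outmap n) (us : List (Cube n)) →
  (∀ {u a} → (u , a) ∈ H → a ≡ s u × u ∈ us) → (queried (algorithm w) s ⊆ us) →
  SinkOrClash s us
algorithm-finds (done (sink u∈)) s us hist qs with hist u∈
... | eq , u∈us = inj₁ (lose u∈us (sym eq))
algorithm-finds (done (clash u∈ v∈ u≢v agr)) s us hist qs with hist u∈ | hist v∈
... | refl , u∈us | refl , v∈us = inj₂ (lose u∈us (lose v∈us (u≢v , agr)))
algorithm-finds (ask u w) s us hist qs = algorithm-finds (w (s u)) s us
  (λ { (here refl) → refl , qs (here refl) ; (there u∈) → hist u∈ }) (qs ∘ there)

Solvable : ℕ → ℕ → Set
Solvable n c = Win {n} Found c []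

t≤ : Solvable n c → t n ≤ c
t≤ {n} {c} w = ℕ.≤-trans
  (proj₂ (t-isMinimum n) (algorithm w) λ s → algorithm-finds w s _ (λ ()) id)
  (let (s , attained) , _ = worstCase-isMaximum (algorithm w)
   in subst (_≤ c) attained (queryCount-algorithm w s))

-- Faces

-- Coordinates of the n-cube, split in k quotient and i face coordinates:
-- join q is the embedding of the i-cube as the face over the vertex q.
record View (k i n : ℕ) : Set where
  field
    join            : Cube k → Cube i → Cube n
    join-injective  : ∀ {q q′ v v′} → join q v ≡ join q′ v′ → q ≡ q′ × v ≡ v′
    -- The same `join` splits answers: `x` is the quotient part of `a` and `w` its face part.
    join-surjective : ∀ a → ∃₂ λ x w → join x w ≡ a
    join-0ⁿ         : join 0ⁿ 0ⁿ ≡ 0ⁿ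
    join-agree      : ∀ {x x′ q q′ w w′ v v′} → Agree x x′ q q′ → Agree w w′ v v′ →
                      Agree (join x w) (join x′ w′) (join q v) (join q′ v′)

open View

whole : View n 0 n
whole .join q _ = q
whole .join-injective {v = []} {[]} eq = eq , refl
whole .join-surjective a = a , [] , refl
whole .join-0ⁿ = refl
whole .join-agree agr _ = agr

-- The first quotient coordinate becomes a face coordinate: the faces over `false ∷ q` and
-- `true ∷ q` are the halves of the new face over `q`.
merge : View (suc k) i n → View k (suc i) n
merge V .join q (b ∷ v) = join V (b ∷ q) v
merge V .join-injective {v = _ ∷ _} {_ ∷ _} eq with join-injective V eq
... | refl , refl = refl , refl
merge V .join-surjective a with join-surjective V a
... | b ∷ x , w , eq = x , b ∷ w , eq
merge V .join-0ⁿ = join-0ⁿ V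
merge V .join-agree {w = _ ∷ _} {_ ∷ _} {_ ∷ _} {_ ∷ _} agr agr′ with ∷-injective agr′
... | eq , agr″ = join-agree V (cong₂ _∷_ eq agr) agr″

toFront fromFront : Fin (suc k) → Cube (suc k) → Cube (suc k)
toFront   l q       = lookup q l ∷ removeAt q l
fromFront l (b ∷ q) = insertAt q l b

toFront-fromFront : ∀ l (q : Cube (suc k)) → toFront l (fromFront l q) ≡ q
toFront-fromFront l (b ∷ q) = cong₂ _∷_ (insertAt-lookup q l b) (removeAt-insertAt q l b)

fromFront-toFront : ∀ l (q : Cube (suc k)) → fromFront l (toFront l q) ≡ q
fromFront-toFront l q = insertAt-removeAt q l

fromFront-replicate : ∀ l b → fromFront l (replicate (suc k) b) ≡ replicate (suc k) b
fromFront-replicate         zero    b = refl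
fromFront-replicate {suc k} (suc l) b = cong (b ∷_) (fromFront-replicate l b)

fromFront-agree : ∀ l {x x′ q q′ : Cube (suc k)} → Agree x x′ q q′ →
  Agree (fromFront l x) (fromFront l x′) (fromFront l q) (fromFront l q′)
fromFront-agree zero {_ ∷ _} {_ ∷ _} {_ ∷ _} {_ ∷ _} agr = agr
fromFront-agree (suc l) {_ ∷ _ ∷ _} {_ ∷ _ ∷ _} {_ ∷ _ ∷ _} {_ ∷ _ ∷ _} agr
  with ∷-injective agr
... | eq , agr′ with ∷-injective agr′
...   | eq′ , agr″ = cong₂ _∷_ eq′ (fromFront-agree l (cong₂ _∷_ eq agr″))

moveFront : Fin (suc k) → View (suc k) i n → View (suc k) i n
moveFront l V .join q v = join V (fromFront l q) v
moveFront l V .join-injective {q} {q′} eq with join-injective V eq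
... | eq₁ , eq₂ =
  trans (sym (toFront-fromFront l q)) (trans (cong (toFront l) eq₁) (toFront-fromFront l q′)) , eq₂
moveFront l V .join-surjective a with join-surjective V a
... | x , w , eq = toFront l x , w , trans (cong (λ x → join V x w) (fromFront-toFront l x)) eq
moveFront l V .join-0ⁿ =
  trans (cong (λ q → join V q 0ⁿ) (fromFront-replicate l false)) (join-0ⁿ V)
moveFront l V .join-agree agr = join-agree V (fromFront-agree l agr)

-- The inherited outmap, whose value at q is the quotient part of the answer
-- at a sink of the face over q, is known to be x at q.
Known : View k i n → Cube k → Cube k → History n → Set
Known V q x H = ∃ λ v → (join V q v , join V x 0ⁿ) ∈ H

Known-mono : (V : View k i n) {q x : Cube k} {H H′ : History n} →
             H ⊆ H′ → Known V q x H → Known V q x H′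
Known-mono V sub (v , v∈) = v , sub v∈

Known-sink : (V : View k i n) {q : Cube k} {H : History n} → Known V q 0ⁿ H → Found H
Known-sink V {q} {H} (v , v∈) = sink (subst (λ a → (join V q v , a) ∈ H) (join-0ⁿ V) v∈)

-- Both answers have face part `0ⁿ`, so the face coordinates agree wherever the two sinks lie in
-- their faces.
Known-clash : (V : View k i n) {q q′ x x′ : Cube k} {H : History n} →
  Known V q x H → Known V q′ x′ H → q ≢ q′ → Agree x x′ q q′ → Found H
Known-clash V (v , v∈) (v′ , v′∈) q≢q′ agr =
  clash v∈ v′∈ (q≢q′ ∘ proj₁ ∘ join-injective V) (join-agree V agr (agree-answer 0ⁿ v v′))

-- Constant vertices suffice: the seesaw tracks only the poles, which every permutation of
-- coordinates fixes.
Known-moveFront : (V : View (suc k) i n) (l : Fin (suc k)) (b : Bool) {x : Cube (suc k)} {H : History n} →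
  Known V (replicate _ b) x H → Known (moveFront l V) (replicate _ b) (toFront l x) H
Known-moveFront V l b {x} {H} (v , v∈) = v , subst₂ (λ q x → (join V q v , join V x 0ⁿ) ∈ H)
  (sym (fromFront-replicate l b)) (sym (fromFront-toFront l x)) v∈

-- The strategy for the `i`-cube is played inside the face over `q`, and `h` records only the face
-- parts of the answers. A clash in `h` lifts because its two vertices share the quotient part `q`.
evaluate : {h : History i} → Win Found c h → (V : View k i n) (q : Cube k) {H : History n} →
  (∀ {v w} → (v , w) ∈ h → ∃ λ x → (join V q v , join V x w) ∈ H) →
  Win ((λ H → ∃ λ x → Known V q x H) ∨Found) c H
evaluate (done (sink v∈)) V q emb with emb v∈
... | x , v∈′ = done (inj₂ (x , _ , v∈′))
evaluate (done (clash v∈ v′∈ v≢v′ agr)) V q emb with emb v∈ | emb v′∈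
... | x , u∈ | x′ , u′∈ = done (inj₁ (clash u∈ u′∈ (v≢v′ ∘ proj₂ ∘ join-injective V)
  (join-agree V (agree-vertex x x′ q) agr)))
evaluate (ask v f) V q {H} emb = ask (join V q v) λ a →
  let x , w , eq = join-surjective V a in
  evaluate (f w) V q λ
    { (here refl) → x , here (cong (join V q v ,_) eq)
    ; (there v∈)  → let x′ , u∈ = emb v∈ in x′ , there u∈ }

evaluateAt : Solvable i c → (V : View k i n) (q : Cube k) {H : History n} →
             Win ((λ H → ∃ λ x → Known V q x H) ∨Found) c H
evaluateAt sol V q = evaluate sol V q (λ ())

quotient-win : {h : History k} → Win Found c h → Solvable i m →
  (V : View k i n) {H : History n} → (∀ {q x} → (q , x) ∈ h → Known V q x H) →
  Win Found (c * m) H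
quotient-win (done (sink q∈)) sol V kn = done (Known-sink V (kn q∈))
quotient-win (done (clash q∈ q′∈ q≢q′ agr)) sol V kn =
  done (Known-clash V (kn q∈) (kn q′∈) q≢q′ agr)
quotient-win (ask q f) sol V kn = evaluateAt sol V q >>= λ
  { sub (inj₁ found)    → done found
  ; sub (inj₂ (x , kx)) → quotient-win (f x) sol V λ
      { (here refl) → kx ; (there q∈) → Known-mono V sub (kn q∈) } }

-- The seesaw

Antipodal : (k i : ℕ) → History n → Set
Antipodal {n} k i H = ∃ λ (V : View k i n) → ∃₂ λ x y → Known V 0ⁿ x H × Known V 1ⁿ y H

differ : {x y : Cube k} → x ≢ y → ∃ λ l → lookup x l ≢ lookup y l
differ {x = []}    {[]}    x≢y = ⊥-elim (x≢y refl)
differ {x = a ∷ x} {b ∷ y} x≢y with a Bool.≟ b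
... | no  a≢b  = zero , a≢b
... | yes refl = let l , ne = differ (x≢y ∘ cong (a ∷_)) in suc l , ne

seesaw-step : {H : History n} → Solvable i m → Antipodal (suc k) i H →
              Win (Antipodal k (suc i) ∨Found) m H
seesaw-step {n} {i} {m} {k} {H} sol (V , x , y , kx , ky) with x ≟ y
... | yes refl = done (inj₁ (Known-clash V kx ky (λ ()) (agree-answer x 0ⁿ 1ⁿ)))
... | no x≢y with differ x≢y
...   | l , ne = step (moveFront l V) ne (Known-moveFront V l false kx) (Known-moveFront V l true ky)
  where
  step : (V : View (suc k) i n) {b b′ : Bool} {x y : Cube k} → b ≢ b′ →
         Known V 0ⁿ (b ∷ x) H → Known V 1ⁿ (b′ ∷ y) H → Win (Antipodal k (suc i) ∨Found) m H
  step V {false} {false} ne _ _ = ⊥-elim (ne refl)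
  step V {true}  {true}  ne _ _ = ⊥-elim (ne refl)
  -- The answer over `0ⁿ` is `false` in the new face coordinate, so that sink survives the
  -- extension; the face over `1ⁿ` gets its new half evaluated.
  step V {false} {true} {x} {y} _ kx@(v , v∈) ky = Win-weaken (ℕ.≤-reflexive (ℕ.+-identityʳ m))
    (evaluateAt sol V (false ∷ 1ⁿ) >>= λ
      { sub (inj₁ found)                → done (inj₁ found)
      -- The faces over `false ∷ 1ⁿ` and `true ∷ 1ⁿ` differ only in the first coordinate, where both
      -- answers are `true`.
      ; sub (inj₂ (true ∷ z , kz))      → done (inj₁
          (Known-clash V kz (Known-mono V sub ky) (λ ()) (cong (false ∷_) (agree-vertex z y 1ⁿ))))
      ; sub (inj₂ (false ∷ z , w , w∈)) → done (inj₂
          (merge V , x , z , (false ∷ v , sub v∈) , (false ∷ w , w∈)))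
      })
  step V {true} {false} {x} {y} _ kx ky@(v , v∈) = Win-weaken (ℕ.≤-reflexive (ℕ.+-identityʳ m))
    (evaluateAt sol V (true ∷ 0ⁿ) >>= λ
      { sub (inj₁ found)                → done (inj₁ found)
      ; sub (inj₂ (true ∷ z , kz))      → done (inj₁
          (Known-clash V kz (Known-mono V sub kx) (λ ()) (cong (false ∷_) (agree-vertex z x 0ⁿ))))
      ; sub (inj₂ (false ∷ z , w , w∈)) → done (inj₂
          (merge V , z , y , (true ∷ w , w∈) , (true ∷ v , sub v∈)))
      })

-- Seven queries on the 4-cube

separated : (a b u v : Cube n) → Bool
separated []       []       []       []       = false
separated (a ∷ as) (b ∷ bs) (u ∷ us) (v ∷ vs) = (a xor b) ∧ (u xor v) ∨ separated as bs us vs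

separated-or-agree : (a b u v : Cube n) → T (separated a b u v) ⊎ Agree a b u v
separated-or-agree []       []       []       []       = inj₂ refl
separated-or-agree (a ∷ as) (b ∷ bs) (u ∷ us) (v ∷ vs)
  with (a xor b) ∧ (u xor v) | separated-or-agree as bs us vs
... | true  | _        = inj₁ _
... | false | inj₁ sep = inj₁ sep
... | false | inj₂ agr = inj₂ (cong (false ∷_) agr)

cubes : ∀ n → List (Cube n)
cubes zero    = [] ∷ []
cubes (suc n) = cartesianProductWith _∷_ (false ∷ true ∷ []) (cubes n)

∈-cubes : (u : Cube n) → u ∈ cubes n
∈-cubes []      = here refl
∈-cubes (b ∷ u) = ∈-cartesianProductWith⁺ _∷_ (∈-bools b) (∈-cubes u)
  where
  ∈-bools : ∀ b → b ∈ false ∷ true ∷ []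
  ∈-bools false = here refl
  ∈-bools true  = there (here refl)

-- Vertices that may still be queried, with the answers that neither give a
-- sink nor clash with the history.
Candidates : ℕ → Set
Candidates n = List (Cube n × List (Cube n))

Covers : Candidates n → History n → Set
Covers R H = All (λ (u , as) → ∀ a → a ∈ as ⊎ Found ((u , a) ∷ H)) R

record-answer : (u a : Cube n) → Candidates n → Candidates n
record-answer u a [] = []
record-answer u a ((v , bs) ∷ R) =
  if ⌊ u ≟ v ⌋ then record-answer u a R
  else (v , filterᵇ (λ b → separated a b u v) bs) ∷ record-answer u a R

Covers-record : ∀ u a (R : Candidates n) {H} → Covers R H → Covers (record-answer u a R) ((u , a) ∷ H)
Covers-record u a [] [] = []
Covers-record u a ((v , bs) ∷ R) {H} (cov ∷ covs) with u ≟ v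
... | yes _  = Covers-record u a R covs
... | no u≢v = cov′ ∷ Covers-record u a R covs
  where
  cov′ : ∀ b → b ∈ filterᵇ (λ b → separated a b u v) bs ⊎ Found ((v , b) ∷ (u , a) ∷ H)
  cov′ b with cov b | separated-or-agree a b u v
  ... | inj₁ b∈    | inj₁ sep = inj₁ (∈-filter⁺ (λ b → T? (separated a b u v)) b∈ sep)
  ... | inj₁ _     | inj₂ agr = inj₂ (clash (there (here refl)) (here refl) u≢v agr)
  ... | inj₂ found | _        = inj₂ (Found-mono
    (λ { (here refl) → here refl ; (there w∈) → there (there w∈) }) found)

-- The first disjunct is an instance of the second; it is tested first to prune the search.
wins : ℕ → Candidates n → Bool
wins zero    R = false
wins (suc c) R = Bool.any (λ (_ , as) → null as) R ∨
  Bool.any (λ (u , as) → Bool.all (λ a → wins c (record-answer u a R)) as) R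

-- Any answer outside the candidate list completes a sink or a clash at once. Hence a vertex with an
-- empty list wins by a single query.
wins-sound : ∀ c {R : Candidates n} {H} → T (wins c R) → Covers R H → Win Found c H
wins-sound {n} (suc c) {R} {H} win cov with find (forced win)
  where
  null⇒all : ∀ {A : Set} (p : A → Bool) xs → T (null xs) → T (Bool.all p xs)
  null⇒all p [] _ = _
  forced : T (wins (suc c) R) →
    Any (λ (u , as) → T (Bool.all (λ a → wins c (record-answer u a R)) as)) R
  forced = [ Any.map (λ {(u , as)} → null⇒all (λ a → wins c (record-answer u a R)) as) ∘ any⁻ _ R
           , any⁻ _ R ] ∘ Equivalence.to T-∨
... | (u , as) , u∈ , all-win = ask u answered
  where
  answered : ∀ a → Win Found c ((u , a) ∷ H)
  answered a with All.lookup cov u∈ a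
  ... | inj₁ a∈    = wins-sound c (All.lookup (all⁺ _ _ all-win) a∈) (Covers-record u a R cov)
  ... | inj₂ found = done found

-- Querying the middle layer first keeps the search small.
start : Candidates 4
start = map (λ u → u , filterᵇ (λ a → not ⌊ a ≟ 0ⁿ ⌋) (cubes 4))
  (filterᵇ middle (cubes 4) ++ filterᵇ (not ∘ middle) (cubes 4))
  where
  middle : Cube 4 → Bool
  middle u = count T? u ≡ᵇ 2

Covers-start : Covers start []
Covers-start = map⁺ (All.universal nonzero _)
  where
  nonzero : ∀ u (a : Cube 4) →
    a ∈ filterᵇ (λ a → not ⌊ a ≟ 0ⁿ ⌋) (cubes 4) ⊎ Found ((u , a) ∷ [])
  nonzero u a with T? (not ⌊ a ≟ 0ⁿ ⌋)
  ... | yes a≢0 = inj₁ (∈-filter⁺ (λ a → T? (not ⌊ a ≟ 0ⁿ ⌋)) (∈-cubes a) a≢0)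
  ... | no  a≡0 with a ≟ 0ⁿ
  ...   | yes refl = inj₂ (sink (here refl))
  ...   | no  _    = ⊥-elim (a≡0 _)

afterPoles : (x y : Cube 4) → Candidates 4
afterPoles x y = record-answer 1ⁿ y (record-answer 0ⁿ x start)

-- In the first three cases the poles alone end the game, by a sink or a clash.
poleWins : (x y : Cube 4) → Candidates 4 → Bool
poleWins x y R = ⌊ x ≟ 0ⁿ ⌋ ∨ ⌊ y ≟ 0ⁿ ⌋ ∨ ⌊ x ≟ y ⌋ ∨ wins 5 R

poleWins-sound : ∀ x y R {H} → (1ⁿ , y) ∈ H → (0ⁿ , x) ∈ H → Covers R H →
                 T (poleWins x y R) → Win Found 5 H
poleWins-sound x y R {H} 1∈ 0∈ cov =
  ∨-elim (x≡0 ∘ toWitness {a? = x ≟ 0ⁿ}) (∨-elim (y≡0 ∘ toWitness {a? = y ≟ 0ⁿ})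
    (∨-elim (x≡y ∘ toWitness {a? = x ≟ y}) (λ win → wins-sound 5 win cov)))
  where
  ∨-elim : ∀ {a b} {A : Set} → (T a → A) → (T b → A) → T (a ∨ b) → A
  ∨-elim f g = [ f , g ] ∘ Equivalence.to T-∨
  x≡0 : x ≡ 0ⁿ → Win Found 5 H
  x≡0 refl = done (sink 0∈)
  y≡0 : y ≡ 0ⁿ → Win Found 5 H
  y≡0 refl = done (sink 1∈)
  x≡y : x ≡ y → Win Found 5 H
  x≡y refl = done (clash 1∈ 0∈ (λ ()) (agree-answer x 1ⁿ 0ⁿ))

-- Only pairs whose columns (xₗ , yₗ) are in lexicographic order are searched;
-- moving coordinates to the front reduces every pair to such a pair.
ordered : (x y : Cube n) → Bool
ordered (a ∷ b ∷ x) (c ∷ d ∷ y) = (if a xor b then b else not c ∨ d) ∧ ordered (b ∷ x) (d ∷ y)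
ordered _           _           = true

toFronts : List (Fin 4) → Cube 4 → Cube 4
toFronts []       x = x
toFronts (l ∷ ls) x = toFronts ls (toFront l x)

-- Three moves to the front yield every order of four coordinates: bring forward the one wanted
-- third, then second, then first.
reorderings : List (List (Fin 4))
reorderings = cartesianProductWith _∷_ (allFin 4)
  (cartesianProductWith (λ l l′ → l ∷ l′ ∷ []) (allFin 4) (allFin 4))

forAllPairs : (Cube 4 → Cube 4 → Bool) → Bool
forAllPairs p = Bool.all (λ x → Bool.all (p x) (cubes 4)) (cubes 4)

forAllPairs-sound : ∀ p → forAllPairs p ≡ true → ∀ x y → T (p x y)
forAllPairs-sound p eq x y = All.lookup (all⁺ (p x) (cubes 4)
  (All.lookup (all⁺ (λ x → Bool.all (p x) (cubes 4)) (cubes 4) (subst T (sym eq) _)) (∈-cubes x))) (∈-cubes y)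

orderable? orderedWins? : (x y : Cube 4) → Bool
orderable?   x y = Bool.any (λ ls → ordered (toFronts ls x) (toFronts ls y)) reorderings
orderedWins? x y = not (ordered x y) ∨ poleWins x y (afterPoles x y)

opaque
  -- Verified, like `orderedWins`, by evaluation on all 256 pairs of pole answers.
  orderable : ∀ x y → T (orderable? x y)
  orderable = forAllPairs-sound orderable? refl

  orderedWins : ∀ x y → T (orderedWins? x y)
  orderedWins = forAllPairs-sound orderedWins? refl

finish₄ : {H : History n} → Solvable i m → Antipodal 4 i H → Win Found (5 * m) H
finish₄ {n} {i} {m} {H} sol (V , x , y , kx , ky) =
  let ls , ord = Any.satisfied
        (any⁻ (λ ls → ordered (toFronts ls x) (toFronts ls y)) reorderings (orderable x y))
  in go ls V kx ky ord
  where
  go : ∀ ls (V : View 4 i n) {x y} → Known V 0ⁿ x H → Known V 1ⁿ y H →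
       T (ordered (toFronts ls x) (toFronts ls y)) → Win Found (5 * m) H
  go (l ∷ ls) V kx ky ord =
    go ls (moveFront l V) (Known-moveFront V l false kx) (Known-moveFront V l true ky) ord
  go [] V {x} {y} kx ky ord =
    -- The two poles form the initial history and are already known, so only the five further
    -- queries cost an evaluation each.
    quotient-win
      (poleWins-sound x y (afterPoles x y) (here refl) (there (here refl))
        (Covers-record 1ⁿ y _ (Covers-record 0ⁿ x start Covers-start))
        (not-∨ (orderedWins x y) ord))
      sol V λ { (here refl) → ky ; (there (here refl)) → kx }
    where
    not-∨ : ∀ {a b} → T (not a ∨ b) → T a → T b
    not-∨ {true} tb _ = tb

-- Strategies in every dimension

finish₁ : {H : History n} → Antipodal 1 i H → Found H
finish₁ (V , false ∷ [] , _ , kx , _) = Known-sink V kx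
finish₁ (V , true ∷ [] , false ∷ [] , _ , ky) = Known-sink V ky
finish₁ (V , true ∷ [] , true ∷ [] , kx , ky) = Known-clash V kx ky (λ ()) refl

-- seesawBound j counts the queries until sinks of two antipodal j-faces are known.
mutual
  queryBound : ℕ → ℕ
  queryBound 0 = 1
  queryBound 1 = seesawBound 0
  queryBound 2 = seesawBound 1
  queryBound 3 = seesawBound 2
  queryBound (suc (suc (suc (suc n)))) = seesawBound n + 5 * queryBound n

  seesawBound : ℕ → ℕ
  seesawBound zero    = 2
  seesawBound (suc n) = seesawBound n + queryBound n

mutual
  -- In dimensions 1 to 3 the seesaw runs until one quotient coordinate is left, where the two known
  -- answers suffice. From dimension 4 on it stops at a quotient 4-cube.
  solvable : ∀ n → Solvable n (queryBound n)
  solvable 0 = ask [] λ { [] → done (sink (here refl)) }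
  solvable 1 = Win-map [ id , finish₁ ] (seesaw 0 refl)
  solvable 2 = Win-map [ id , finish₁ ] (seesaw 1 refl)
  solvable 3 = Win-map [ id , finish₁ ] (seesaw 2 refl)
  solvable (suc (suc (suc (suc n)))) = seesaw n (ℕ.+-comm n 4) >>= λ _ →
    [ done , finish₄ (solvable n) ]

  seesaw : ∀ j → j + k ≡ n → Win {n} (Antipodal k j ∨Found) (seesawBound j) []
  seesaw zero refl = ask 0ⁿ λ x → ask 1ⁿ λ y →
    done (inj₂ (whole , x , y , ([] , there (here refl)) , ([] , here refl)))
  seesaw {k} (suc j) eq = seesaw j (trans (ℕ.+-suc j k) eq) >>= λ _ →
    [ done ∘ inj₁ , seesaw-step (solvable j) ]

-- Growth of the query bound

-- The growth rate 1.61 enters here as 100⁴ (200 + 305 · 2) ≤ 122 · 161⁴.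
queryBound-step : ∀ p q u τ h g → 810 * p ≤ 122 * q →
  u * h * 61 ≤ 200 * g → τ * h ≤ 2 * g → (u + 5 * τ) * (p * h) ≤ 2 * (q * g)
queryBound-step p q u τ h g p≤q u≤ τ≤ = ℕ.*-cancelʳ-≤ _ _ 61 (begin
  (u + 5 * τ) * (p * h) * 61               ≡⟨ split u τ p h ⟩
  p * (u * h * 61) + p * 305 * (τ * h)     ≤⟨ ℕ.+-mono-≤ (ℕ.*-monoʳ-≤ p u≤) (ℕ.*-monoʳ-≤ (p * 305) τ≤) ⟩
  p * (200 * g) + p * 305 * (2 * g)        ≡⟨ gather p g ⟩
  810 * p * g                              ≤⟨ ℕ.*-monoˡ-≤ g p≤q ⟩
  122 * q * g                              ≡⟨ unscale q g ⟩
  2 * (q * g) * 61                         ∎)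
  where
  open ℕ.≤-Reasoning
  split : ∀ u τ p h → (u + 5 * τ) * (p * h) * 61 ≡ p * (u * h * 61) + p * 305 * (τ * h)
  split = solve-∀
  gather : ∀ p g → p * (200 * g) + p * 305 * (2 * g) ≡ 810 * p * g
  gather = solve-∀
  unscale : ∀ q g → 122 * q * g ≡ 2 * (q * g) * 61
  unscale = solve-∀

-- The constant `200 / 61` is `2 / 0.61`, the fixed point of adding `2` and dividing by `1.61`; the
-- induction step therefore holds with no slack.
seesawBound-step : ∀ u τ h g → u * h * 61 ≤ 200 * g → τ * h ≤ 2 * g →
  (u + τ) * (100 * h) * 61 ≤ 200 * (161 * g)
seesawBound-step u τ h g u≤ τ≤ = begin
  (u + τ) * (100 * h) * 61               ≡⟨ split u τ h ⟩
  100 * (u * h * 61) + 6100 * (τ * h)    ≤⟨ ℕ.+-mono-≤ (ℕ.*-monoʳ-≤ 100 u≤) (ℕ.*-monoʳ-≤ 6100 τ≤) ⟩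
  100 * (200 * g) + 6100 * (2 * g)       ≡⟨ gather g ⟩
  200 * (161 * g)                        ∎
  where
  open ℕ.≤-Reasoning
  split : ∀ u τ h → (u + τ) * (100 * h) * 61 ≡ 100 * (u * h * 61) + 6100 * (τ * h)
  split = solve-∀
  gather : ∀ g → 100 * (200 * g) + 6100 * (2 * g) ≡ 200 * (161 * g)
  gather = solve-∀

mutual
  queryBound-growth : ∀ n → queryBound n * 100 ℕ.^ n ≤ 2 * 161 ℕ.^ n
  queryBound-growth 0 = ℕ.≤ᵇ⇒≤ _ _ _
  queryBound-growth 1 = ℕ.≤ᵇ⇒≤ _ _ _
  queryBound-growth 2 = ℕ.≤ᵇ⇒≤ _ _ _
  queryBound-growth 3 = ℕ.≤ᵇ⇒≤ _ _ _
  queryBound-growth (suc (suc (suc (suc n)))) =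
    subst₂ (λ x y → queryBound (4 + n) * x ≤ 2 * y)
      (sym (ℕ.^-distribˡ-+-* 100 4 n)) (sym (ℕ.^-distribˡ-+-* 161 4 n))
      (queryBound-step (100 ℕ.^ 4) (161 ℕ.^ 4) (seesawBound n) (queryBound n) (100 ℕ.^ n) (161 ℕ.^ n)
        (ℕ.≤ᵇ⇒≤ (810 * 100 ℕ.^ 4) (122 * 161 ℕ.^ 4) _) (seesawBound-growth n) (queryBound-growth n))

  seesawBound-growth : ∀ n → seesawBound n * 100 ℕ.^ n * 61 ≤ 200 * 161 ℕ.^ n
  seesawBound-growth zero    = ℕ.≤ᵇ⇒≤ _ _ _
  seesawBound-growth (suc n) = seesawBound-step (seesawBound n) (queryBound n) (100 ℕ.^ n) (161 ℕ.^ n)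
    (seesawBound-growth n) (queryBound-growth n)

-- Transfer to powers of a rational number

ι : ℕ → ℚ
ι k = + k / 1

toℚᵘ-ι : ∀ k → ℚ.toℚᵘ (ι k) ℚᵘ.≃ ℚᵘ.mkℚᵘ (+ k) 0
toℚᵘ-ι k = ℚ.toℚᵘ-fromℚᵘ (ℚᵘ.mkℚᵘ (+ k) 0)

ι-* : ∀ a b → ι a ℚ.* ι b ≡ ι (a * b)
ι-* a b = ℚ.toℚᵘ-injective (begin
  ℚ.toℚᵘ (ι a ℚ.* ι b)                    ≈⟨ ℚ.toℚᵘ-homo-* (ι a) (ι b) ⟩
  ℚ.toℚᵘ (ι a) ℚᵘ.* ℚ.toℚᵘ (ι b)          ≈⟨ ℚᵘ.*-cong (toℚᵘ-ι a) (toℚᵘ-ι b) ⟩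
  ℚᵘ.mkℚᵘ (+ a ℤ.* + b) 0                 ≡⟨ cong (λ i → ℚᵘ.mkℚᵘ i 0) (ℤ.pos-* a b) ⟨
  ℚᵘ.mkℚᵘ (+ (a * b)) 0                   ≈⟨ toℚᵘ-ι (a * b) ⟨
  ℚ.toℚᵘ (ι (a * b))                      ∎)
  where open ℚᵘ.≃-Reasoning

ι-mono-≤ : ∀ {a b} → a ≤ b → ι a ℚ.≤ ι b
ι-mono-≤ {a} {b} a≤b = ℚ.toℚᵘ-cancel-≤ (begin
  ℚ.toℚᵘ (ι a)        ≃⟨ toℚᵘ-ι a ⟩
  ℚᵘ.mkℚᵘ (+ a) 0     ≤⟨ ℚᵘ.*≤* (ℤ.*-monoʳ-≤-nonNeg (+ 1) (ℤ.+≤+ a≤b)) ⟩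
  ℚᵘ.mkℚᵘ (+ b) 0     ≃⟨ toℚᵘ-ι b ⟨
  ℚ.toℚᵘ (ι b)        ∎)
  where open ℚᵘ.≤-Reasoning

^-nonNeg : ∀ r {{_ : ℚ.NonNegative r}} n → ℚ.NonNegative (r ^ n)
^-nonNeg r zero    = _
^-nonNeg r (suc n) = ℚ.nonNeg*nonNeg⇒nonNeg r (r ^ n) {{^-nonNeg r n}}

^-ι : ∀ r a b → r ℚ.* ι a ≡ ι b → ∀ n → r ^ n ℚ.* ι (a ℕ.^ n) ≡ ι (b ℕ.^ n)
^-ι r a b eq zero    = refl
^-ι r a b eq (suc n) = begin
  r ℚ.* r ^ n ℚ.* ι (a * a ℕ.^ n)           ≡⟨ cong (r ℚ.* r ^ n ℚ.*_) (ι-* a (a ℕ.^ n)) ⟨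
  r ℚ.* r ^ n ℚ.* (ι a ℚ.* ι (a ℕ.^ n))     ≡⟨ interchange r (r ^ n) (ι a) (ι (a ℕ.^ n)) ⟩
  r ℚ.* ι a ℚ.* (r ^ n ℚ.* ι (a ℕ.^ n))     ≡⟨ cong₂ ℚ._*_ eq (^-ι r a b eq n) ⟩
  ι b ℚ.* ι (b ℕ.^ n)                       ≡⟨ ι-* b (b ℕ.^ n) ⟩
  ι (b * b ℕ.^ n)                           ∎
  where
  open ≡-Reasoning
  open CommutativeSemigroup (CommutativeMonoid.commutativeSemigroup ℚ.*-1-commutativeMonoid)
    using (interchange)

-- Here `r` is `b / a`; multiplying by the positive number `a ^ n` clears the denominators.
ι≤*^ : ∀ r a b {{_ : ℕ.NonZero a}} → r ℚ.* ι a ≡ ι b →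
       ∀ m c n → m * a ℕ.^ n ≤ c * b ℕ.^ n → ι m ℚ.≤ ι c ℚ.* r ^ n
ι≤*^ r a b eq m c n m≤ = ℚ.*-cancelʳ-≤-pos (ι (a ℕ.^ n)) {{positive}} (begin
  ι m ℚ.* ι (a ℕ.^ n)                 ≡⟨ ι-* m (a ℕ.^ n) ⟩
  ι (m * a ℕ.^ n)                     ≤⟨ ι-mono-≤ m≤ ⟩
  ι (c * b ℕ.^ n)                     ≡⟨ ι-* c (b ℕ.^ n) ⟨
  ι c ℚ.* ι (b ℕ.^ n)                 ≡⟨ cong (ι c ℚ.*_) (^-ι r a b eq n) ⟨
  ι c ℚ.* (r ^ n ℚ.* ι (a ℕ.^ n))     ≡⟨ ℚ.*-assoc (ι c) (r ^ n) (ι (a ℕ.^ n)) ⟨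
  ι c ℚ.* r ^ n ℚ.* ι (a ℕ.^ n)       ∎)
  where
  open ℚ.≤-Reasoning
  positive : ℚ.Positive (ι (a ℕ.^ n))
  positive = ℚ.normalize-pos (a ℕ.^ n) 1 {{_}} {{ℕ.m^n≢0 a n}}

∣-∣-bound : ∀ p q c → ℚ.NonNegative p → ℚ.NonNegative q →
            p ℚ.≤ c ℚ.* q → ℚ.∣ p ∣ ℚ.≤ c ℚ.* ℚ.∣ q ∣
∣-∣-bound p q c 0≤p 0≤q = subst₂ (λ x y → x ℚ.≤ c ℚ.* y)
  (sym (ℚ.0≤p⇒∣p∣≡p (ℚ.nonNegative⁻¹ p {{0≤p}}))) (sym (ℚ.0≤p⇒∣p∣≡p (ℚ.nonNegative⁻¹ q {{0≤q}})))

lemma21 : (λ n → + t n / 1) ∈O (λ n → (+ 161 / 100) ^ n)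
lemma21 = ι 2 , 0 , λ n _ →
  ∣-∣-bound (ι (t n)) (r ^ n) (ι 2) (ℚ.normalize-nonNeg (t n) 1) (^-nonNeg r n)
    (ι≤*^ r 100 161 refl (t n) 2 n
      (ℕ.≤-trans (ℕ.*-monoˡ-≤ (100 ℕ.^ n) (t≤ (solvable n))) (queryBound-growth n)))
  where
  r = + 161 / 100
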